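{- Let $\mathcal{G}=(V,E,p)$ be an uncertain graph, let $0<\alpha<1$, and let $t\ge 2$ be an integer. The algorithm LARGE-MULE, given $\mathcal{G}$, $\alpha$ and $t$, enumerates every $\alpha$-maximal clique of $\mathcal{G}$ with more than $t$ vertices.
   Context: An uncertain graph is a triple $\mathcal{G}=(V,E,p)$, where $V$ is a finite set of vertices, $E$ is a set of undirected edges on $V$ (no self-loops, no multiple edges), and $p:E\to(0,1]$. It represents the distribution over subgraphs of $(V,E)$ obtained by including each edge $e\in E$ independently with probability $p(e)$. For $C\subseteq V$, $\mathrm{clq}(C,\mathcal{G})$ is the probability that $C$ is a clique (all pairs of distinct vertices adjacent) in a sampled graph; $\mathrm{clq}(\emptyset,\mathcal{G})=1$. $C$ is an $\alpha$-clique if $\mathrm{clq}(C,\mathcal{G})\ge\alpha$. $M\subseteq V$ is an $\alpha$-maximal clique if $M$ is an $\alpha$-clique and there is no $v\in V\setminus M$ such that $M\cup\{v\}$ is an $\alpha$-clique. $\Gamma(u)$ is the set of vertices adjacent to $u$ in the (current) graph. Vertices are identified with integers $1,2,\dots,n$; $\max(C)$ is the largest vertex of $C$, with $\max(\emptyset)=0$. Edges $e$ with $p(e)<\alpha$ are removed at the outset. Algorithm LARGE-MULE: Pruning step (applied recursively): drop all edges $\{u,v\}$ such that $|\Gamma(u)\cap\Gamma(v)|<t-2$; then drop every vertex $v$ that does not satisfy the condition that there exist at least $t-1$ vertices $u\in\Gamma(v)$ with $|\Gamma(u)\cap\Gamma(v)|\ge t-2$. Let $\mathcal{G}'$ be the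 resulting uncertain graph (with the restriction of $p$). Enumeration step, on $\mathcal{G}'$ (with $\Gamma$ and $p$ now referring to $\mathcal{G}'$): set $\hat I=\{(u,1): u \text{ a vertex of } \mathcal{G}'\}$ and call EnumLarge$(\emptyset,1,\hat I,\emptyset,t)$. Procedure EnumLarge$(C,q,I,X,t)$, where $C$ is a vertex set, $q$ is a real number, and $I,X$ are sets of pairs (vertex, real number): 1. If $I=\emptyset$ and $X=\emptyset$, output $C$ and return. 2. For each $(u,r)\in I$, in increasing order of $u$: set $C'=C\cup\{u\}$, $q'=q\cdot r$, $I'=\mathrm{GenerateI}(C',q',I)$. If $|C'|+|I'|<t$, continue with the next element of $I$ (skipping the rest of this iteration). Otherwise set $X'=\mathrm{GenerateX}(C',q',X)$, call EnumLarge$(C',q',I',X',t)$, and then replace $X$ by $X\cup\{(u,r)\}$. GenerateI$(C',q',I)$: with $m=\max(C')$, return the set of pairs $(u,\,r\cdot p(\{u,m\}))$ over all $(u,r)\in I$ with $u>m$, $u\in\Gamma(m)$ and $q'\cdot r\cdot p(\{u,m\})\ge\alpha$. GenerateX$(C',q',X)$: with $m=\max(C')$, return the set of pairs $(v,\,s\cdot p(\{v,m\}))$ over all $(v,s)\in X$ with $v\in\Gamma(m)$ and $q'\cdot s\cdot p(\{v,m\})\ge\alpha$. -}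

module Defs where

open import Level using (_⊔_) renaming (suc to lsuc)
open import Algebra.Bundles using (CommutativeRing)
import Algebra.Definitions.RawMonoid as RawMonoid
open import Data.Bool.Base using (if_then_else_)
open import Data.Fin.Base as Fin using (Fin)
import Data.Fin.Properties as Fin
open import Data.Fin.Subset using (Subset; inside; outside; ⊤; ⊥; ⁅_⁆; _∈_; _∉_; _∩_; _∪_; ∣_∣)
open import Data.Fin.Subset.Properties using (_∈?_; x∈⁅x⁆; q⊆p∪q)
open import Data.List.Base as List using (List; []; _∷_; _++_; map; filter; length; allFin; cartesianProduct)
import Data.List.Properties as List
open import Data.List.Membership.Propositional using () renaming (_∈_ to _∈ₗ_)
open import Data.List.Relation.Binary.Subset.Propositional using () renaming (_⊆_ to _⊆ₗ_)
open import Data.List.Relation.Unary.Any as Any using (here; there)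
open import Data.Maybe.Base using (Maybe; just; nothing)
open import Data.Nat.Base as ℕ using (ℕ; zero; suc; _∸_)
import Data.Nat.Properties as ℕ
open import Data.Nat.ListAction using (sum)
open import Data.Nat.Induction using (<-wellFounded)
open import Data.Product.Base using (_×_; _,_; proj₁; ∃)
open import Data.Product.Properties using (≡-dec)
open import Data.Sum.Base using (_⊎_)
open import Data.Vec.Base as Vec using ([]; _∷_; here; there)
open import Function.Base using (_∘_; id)
open import Induction.WellFounded using (Acc; acc)
open import Relation.Binary.Core using (Rel)
open import Relation.Binary.Structures using (IsDecTotalOrder)
import Relation.Binary.Construct.NonStrictToStrict as Strict
open import Relation.Binary.PropositionalEquality.Core using (_≡_; _≢_; refl)
open import Relation.Nullary using (¬_; Dec; yes; no; does)
open import Relation.Nullary.Decidable using (¬?; _×-dec_; _⊎-dec_; _→-dec_)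
open import Relation.Unary using (Pred; Decidable)

-- The scalars.  The classical real numbers are an instance, as is ℚ; the
-- order is decidable because the algorithm branches on it.
record OrderedCommutativeRing c ℓ₁ ℓ₂ : Set (lsuc (c ⊔ ℓ₁ ⊔ ℓ₂)) where
  field
    commutativeRing : CommutativeRing c ℓ₁
  open CommutativeRing commutativeRing public
  infix 4 _≤_
  field
    _≤_             : Rel Carrier ℓ₂
    isDecTotalOrder : IsDecTotalOrder _≈_ _≤_
    +-monoˡ-≤       : ∀ z {x y} → x ≤ y → x + z ≤ y + z
    *-nonNeg        : ∀ {x y} → 0# ≤ x → 0# ≤ y → 0# ≤ x * y
  open IsDecTotalOrder isDecTotalOrder public using (_≤?_)
  open Strict _≈_ _≤_ public using (_<_)

-- Vertex k ∈ {1, …, n} is represented by the element k - 1 of Fin n.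
-- Only the values p u v with v ∈ Γ u are meaningful.
record UncertainGraph {c ℓ₁ ℓ₂} (K : OrderedCommutativeRing c ℓ₁ ℓ₂) (n : ℕ)
       : Set (c ⊔ ℓ₁ ⊔ ℓ₂) where
  open OrderedCommutativeRing K using (Carrier; _≈_; _≤_; _<_; 0#; 1#)
  field
    Γ        : Fin n → Subset n
    Γ-sym    : ∀ {u v} → v ∈ Γ u → u ∈ Γ v
    Γ-irrefl : ∀ {u} → u ∉ Γ u
    p        : Fin n → Fin n → Carrier
    p-sym    : ∀ {u v} → v ∈ Γ u → p u v ≈ p v u
    p-pos    : ∀ {u v} → v ∈ Γ u → 0# < p u v
    p≤1      : ∀ {u v} → v ∈ Γ u → p u v ≤ 1#

-- The subset of all x satisfying P.
select : ∀ {n ℓ} {P : Pred (Fin n) ℓ} → Decidable P → Subset n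
select P? = Vec.tabulate (does ∘ P?)

-- nothing plays the role of max ∅ = 0, which is not a vertex.
max : ∀ {n} → Subset n → Maybe (Fin n)
max []      = nothing
max (s ∷ C) with max C
... | just m  = just (Fin.suc m)
... | nothing = if s then just Fin.zero else nothing

max-nonempty : ∀ {n} {C : Subset n} {u} → u ∈ C → max C ≢ nothing
max-nonempty {C = s ∷ C} u∈C         eq with max C in eq′
max-nonempty {C = s ∷ C} u∈C         () | just _
max-nonempty {C = s ∷ C} here        () | nothing
max-nonempty {C = s ∷ C} (there u∈C) eq | nothing = max-nonempty u∈C eq′

max-upper : ∀ {n} {C : Subset n} {u m} → u ∈ C → max C ≡ just m → u Fin.≤ m
max-upper {C = s ∷ C} here        _  = ℕ.z≤n
max-upper {C = s ∷ C} (there u∈C) eq with max C in eq′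
max-upper {C = s ∷ C} (there u∈C) refl | just m  = ℕ.s≤s (max-upper u∈C eq′)
max-upper {C = s ∷ C} (there u∈C) eq   | nothing with () ← max-nonempty u∈C eq′

module Cliques {c ℓ₁ ℓ₂} {K : OrderedCommutativeRing c ℓ₁ ℓ₂} {n : ℕ}
               (𝒢 : UncertainGraph K n) where
  open OrderedCommutativeRing K hiding (refl)
  open UncertainGraph 𝒢

  edges : List (Fin n × Fin n)
  edges = filter (λ (u , v) → u Fin.<? v ×-dec v ∈? Γ u)
                 (cartesianProduct (allFin n) (allFin n))

  -- A possible outcome of the sampling: the set of edges that are included.
  World : Set
  World = Subset (length edges)

  ∏ : ∀ {m} → (Fin m → Carrier) → Carrier
  ∏ = RawMonoid.sum *-rawMonoid

  -- Sum over all subsets of Fin m.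
  ∑ : ∀ {m} → (Subset m → Carrier) → Carrier
  ∑ {zero}  f = f []
  ∑ {suc m} f = ∑ (λ W → f (inside ∷ W)) + ∑ (λ W → f (outside ∷ W))

  prob : World → Carrier
  prob W = ∏ λ i → let (u , v) = List.lookup edges i in
                   if does (i ∈? W) then p u v else 1# - p u v

  Adjacent : World → Fin n → Fin n → Set
  Adjacent W u v = ∃ λ i → i ∈ W ×
    (List.lookup edges i ≡ (u , v) ⊎ List.lookup edges i ≡ (v , u))

  IsClique : Subset n → World → Set
  IsClique C W = ∀ u v → u ∈ C → v ∈ C → u ≢ v → Adjacent W u v

  isClique? : ∀ C W → Dec (IsClique C W)
  isClique? C W = Fin.all? λ u → Fin.all? λ v →
    u ∈? C →-dec v ∈? C →-dec ¬? (u Fin.≟ v) →-dec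
    Fin.any? λ i → i ∈? W ×-dec
      (≡-dec Fin._≟_ Fin._≟_ (List.lookup edges i) (u , v) ⊎-dec
       ≡-dec Fin._≟_ Fin._≟_ (List.lookup edges i) (v , u))

  clq : Subset n → Carrier
  clq C = ∑ λ W → if does (isClique? C W) then prob W else 0#

  IsαClique : Carrier → Subset n → Set ℓ₂
  IsαClique α C = α ≤ clq C

  IsαMaximalClique : Carrier → Subset n → Set ℓ₂
  IsαMaximalClique α M =
    IsαClique α M × ¬ (∃ λ v → v ∉ M × IsαClique α (M ∪ ⁅ v ⁆))

-- The current graph of the pruning phase: its vertices and neighbourhoods.
record Graph (n : ℕ) : Set where
  constructor graph
  field
    V : Subset n
    Γ : Fin n → Subset n

module Pruning {n : ℕ} (t : ℕ) where

  dropEdges : Graph n → Graph n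
  dropEdges (graph V Γ) = graph V λ u →
    select λ v → v ∈? Γ u ×-dec t ∸ 2 ℕ.≤? ∣ Γ u ∩ Γ v ∣

  dropVertices : Graph n → Graph n
  dropVertices (graph V Γ) = graph V′ λ u →
    if does (u ∈? V′) then Γ u ∩ V′ else ⊥
    where
    V′ : Subset n
    V′ = select λ v → v ∈? V ×-dec
      t ∸ 1 ℕ.≤? ∣ select (λ u → u ∈? Γ v ×-dec t ∸ 2 ℕ.≤? ∣ Γ u ∩ Γ v ∣) ∣

  round : Graph n → Graph n
  round = dropVertices ∘ dropEdges

  -- Every edge is counted twice.
  size : Graph n → ℕ
  size (graph V Γ) = ∣ V ∣ ℕ.+ sum (map (∣_∣ ∘ Γ) (allFin n))

  -- A round only ever deletes, so it changes the graph precisely when it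
  -- decreases the size: this iterates round until nothing more is dropped.
  pruneAcc : (g : Graph n) → Acc ℕ._<_ (size g) → Graph n
  pruneAcc g (acc rs) with size (round g) ℕ.<? size g
  ... | yes smaller = pruneAcc (round g) (rs smaller)
  ... | no  _       = g

  prune : Graph n → Graph n
  prune g = pruneAcc g (<-wellFounded (size g))

-- The sets I and X are lists of pairs without repeated vertices; I is in
-- increasing order of vertices, as Î is and as generateI preserves.
module Enumeration {c ℓ₁ ℓ₂} (K : OrderedCommutativeRing c ℓ₁ ℓ₂) {n : ℕ}
                   (Γ : Fin n → Subset n)
                   (p : Fin n → Fin n → OrderedCommutativeRing.Carrier K)
                   (α : OrderedCommutativeRing.Carrier K) (t : ℕ) where
  open OrderedCommutativeRing K hiding (refl)

  Pairs : Set c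
  Pairs = List (Fin n × Carrier)

  generateI : Subset n → Carrier → Pairs → Pairs
  generateI C′ q′ I with max C′
  ... | nothing = []
  ... | just m  = map (λ (u , r) → u , r * p u m)
    (filter (λ (u , r) → m Fin.<? u ×-dec u ∈? Γ m ×-dec α ≤? q′ * r * p u m) I)

  generateX : Subset n → Carrier → Pairs → Pairs
  generateX C′ q′ X with max C′
  ... | nothing = []
  ... | just m  = map (λ (v , s) → v , s * p v m)
    (filter (λ (v , s) → v ∈? Γ m ×-dec α ≤? q′ * s * p v m) X)

  generateI-shrinks : ∀ C q′ {I u r} → (u , r) ∈ₗ I →
                      length (generateI (C ∪ ⁅ u ⁆) q′ I) ℕ.< length I
  generateI-shrinks C q′ {I} {u} ur∈I with max (C ∪ ⁅ u ⁆) in eq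
  generateI-shrinks C q′ {_ ∷ _} ur∈I | nothing = ℕ.z<s
  generateI-shrinks C q′ {I} {u} ur∈I | just m
    rewrite List.length-map (λ (u , r) → u , r * p u m)
      (filter (λ (u , r) → m Fin.<? u ×-dec u ∈? Γ m ×-dec α ≤? q′ * r * p u m) I)
    = List.filter-notAll _ I
        (Any.map (λ { refl (m<u , _) → ℕ.<⇒≱ m<u (max-upper (q⊆p∪q C ⁅ u ⁆ (x∈⁅x⁆ u)) eq) }) ur∈I)

  mutual
    -- The list of all vertex sets output, in order, by the call
    -- EnumLarge(C, q, I, X, t); the recursion is on the length of I.
    enumLarge : (C : Subset n) (q : Carrier) (I X : Pairs) →
                Acc ℕ._<_ (length I) → List (Subset n)
    enumLarge C q []        []        _        = C ∷ []
    enumLarge C q []        X@(_ ∷ _) (acc rs) = loop C q [] rs [] id X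
    enumLarge C q I@(_ ∷ _) X         (acc rs) = loop C q I rs I id X

    -- J is the part of I still to be traversed.
    loop : (C : Subset n) (q : Carrier) (I : Pairs) →
           (∀ {k} → k ℕ.< length I → Acc ℕ._<_ k) →
           (J : Pairs) → J ⊆ₗ I → (X : Pairs) → List (Subset n)
    loop C q I rs []            J⊆I X = []
    loop C q I rs ((u , r) ∷ J) J⊆I X =
      let C′ = C ∪ ⁅ u ⁆
          q′ = q * r
          I′ = generateI C′ q′ I
          X′ = generateX C′ q′ X
      in if does (∣ C′ ∣ ℕ.+ length I′ ℕ.<? t)
         then loop C q I rs J (J⊆I ∘ there) X
         else enumLarge C′ q′ I′ X′ (rs (generateI-shrinks C q′ (J⊆I (here refl))))
              ++ loop C q I rs J (J⊆I ∘ there) ((u , r) ∷ X)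

-- The vertex sets output by LARGE-MULE, in order.
largeMULE : ∀ {c ℓ₁ ℓ₂} {K : OrderedCommutativeRing c ℓ₁ ℓ₂} {n} →
            UncertainGraph K n → OrderedCommutativeRing.Carrier K → ℕ →
            List (Subset n)
largeMULE {K = K} {n} 𝒢 α t = enumLarge ⊥ 1# Î [] (<-wellFounded (length Î))
  where
  open OrderedCommutativeRing K using (Carrier; 1#; _≤?_)
  open UncertainGraph 𝒢

  𝒢′ : Graph n
  𝒢′ = Pruning.prune t (graph ⊤ λ u → select λ v → v ∈? Γ u ×-dec α ≤? p u v)

  open Enumeration K (Graph.Γ 𝒢′) p α t

  Î : Pairs
  Î = map (_, 1#) (filter (_∈? Graph.V 𝒢′) (allFin n))

{-# OPTIONS --safe #-}
-- The probability of a clique C factorises as the product of p over the pairs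
-- in C, because the indicator of "all these edges are sampled" is a product over
-- the edges.  Hence every pair in M has p ≥ α, and M survives the pruning since
-- any two of its vertices have the |M| - 2 others as common neighbours.  In the
-- enumeration, follow the branch that adds the vertices of M in increasing order:
-- the vertices of M still missing always lie in I, as subsets of M are α-cliques,
-- so the size test never cuts this branch.  When C = M, an element of I or of X
-- would extend M to a larger α-clique, so both are empty and M is output.
module Submission where

open import Defs
import Algebra.Properties.CommutativeMonoid.Sum as Sum
open import Data.Bool.Base using (Bool; true; false; if_then_else_)
open import Data.Fin.Base as Fin using (Fin; zero; suc; toℕ)
import Data.Fin.Properties as Fin
open import Data.Fin.Subset using (Subset; inside; outside; ⊤; ⊥; ⁅_⁆; _∩_; _∪_; ∣_∣)
  renaming (_∈_ to _∈ₛ_; _∉_ to _∉ₛ_; _⊆_ to _⊆ₛ_)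
open import Data.Fin.Subset.Properties
  using (_∈?_; x∈⁅x⁆; x∈⁅y⁆⇒x≡y; x∈p∪q⁺; x∈p∪q⁻; x∈p∩q⁺; p∩q⊆p; p⊆p∪q; q⊆p∪q;
         ⊆-antisym; p⊆q⇒∣p∣≤∣q∣; ∣⊥∣≡0; ∣⁅x⁆∣≡1; ∉⊥; ∈⊤)
open import Data.List.Base as List using (List; []; _∷_; _++_; map; filter; length; allFin; cartesianProduct)
open import Data.List.Membership.Propositional using (_∈_)
open import Data.List.Membership.Propositional.Properties
  using (∈-map⁺; ∈-map⁻; ∈-filter⁺; ∈-filter⁻; ∈-cartesianProduct⁺; ∈-allFin; ∈-lookup; ∈-++⁺ˡ; ∈-++⁺ʳ)
open import Data.List.Relation.Binary.Subset.Propositional using () renaming (_⊆_ to _⊆ₗ_)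
import Data.List.Relation.Unary.All as All
open import Data.List.Relation.Unary.AllPairs using (_∷_)
open import Data.List.Relation.Unary.Any as Any using (here; there)
open import Data.List.Relation.Unary.Any.Properties using (lookup-index; ¬Any[])
open import Data.List.Relation.Unary.Unique.Propositional using (Unique)
import Data.List.Relation.Unary.Unique.Propositional.Properties as Unique
open import Data.Maybe.Base using (just; nothing)
open import Data.Nat.Base as ℕ using (ℕ; _∸_)
open import Data.Nat.Induction using (<-wellFounded)
import Data.Nat.Properties as ℕ
open import Data.Product.Base using (_×_; _,_; proj₁; proj₂; ∃; uncurry)
open import Data.Sum.Base using (inj₁; inj₂; [_,_]′)
open import Data.Vec.Base using ([]; _∷_; here; there)
open import Data.Vec.Properties using (lookup∘tabulate; []=⇒lookup; lookup⇒[]=)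
open import Function.Base using (_∘_; id)
open import Induction.WellFounded using (Acc; acc)
open import Level using (_⊔_)
open import Relation.Binary.Bundles using (Poset)
open import Relation.Binary.Definitions using (tri<; tri≈; tri>)
import Relation.Binary.Reasoning.PartialOrder as ≤-Reasoning
import Relation.Binary.Reasoning.Setoid as ≈-Reasoning
open import Relation.Binary.PropositionalEquality.Core as ≡ using (_≡_; _≢_; refl)
open import Relation.Binary.Structures using (IsDecTotalOrder)
open import Relation.Nullary using (¬_; Dec; yes; no; does; contradiction)
open import Relation.Nullary.Decidable using (¬?; _×-dec_; _→-dec_; decidable-stable; dec-true)
open import Relation.Unary using (Pred; Decidable)

-- Finite sets and lists

Complete : ∀ {n} → (Fin n → Subset n) → Subset n → Set
Complete Γ C = ∀ {u v} → u ∈ₛ C → v ∈ₛ C → u ≢ v → v ∈ₛ Γ u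

∈-select⁺ : ∀ {n ℓ} {P : Pred (Fin n) ℓ} (P? : Decidable P) {x} → P x → x ∈ₛ select P?
∈-select⁺ P? {x} px = lookup⇒[]= x _ (≡.trans (lookup∘tabulate _ x) (dec-true (P? x) px))

∈-select⁻ : ∀ {n ℓ} {P : Pred (Fin n) ℓ} (P? : Decidable P) {x} → x ∈ₛ select P? → P x
∈-select⁻ P? {x} x∈ with P? x | ≡.trans (≡.sym (lookup∘tabulate (does ∘ P?) x)) ([]=⇒lookup x∈)
... | yes px | _ = px
... | no _   | ()

∪⁅⁆-⊆ : ∀ {n} {C D : Subset n} {u} → C ⊆ₛ D → u ∈ₛ D → C ∪ ⁅ u ⁆ ⊆ₛ D
∪⁅⁆-⊆ {C = C} {D} {u} C⊆D u∈D w∈ =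
  [ C⊆D , (λ w∈⁅u⁆ → ≡.subst (_∈ₛ D) (≡.sym (x∈⁅y⁆⇒x≡y u w∈⁅u⁆)) u∈D) ]′ (x∈p∪q⁻ C ⁅ u ⁆ w∈)

∣p∪q∣≤∣p∣+∣q∣ : ∀ {n} (p q : Subset n) → ∣ p ∪ q ∣ ℕ.≤ ∣ p ∣ ℕ.+ ∣ q ∣
∣p∪q∣≤∣p∣+∣q∣ []            []            = ℕ.z≤n
∣p∪q∣≤∣p∣+∣q∣ (outside ∷ p) (outside ∷ q) = ∣p∪q∣≤∣p∣+∣q∣ p q
∣p∪q∣≤∣p∣+∣q∣ (outside ∷ p) (inside ∷ q)  =
  ℕ.≤-trans (ℕ.s≤s (∣p∪q∣≤∣p∣+∣q∣ p q)) (ℕ.≤-reflexive (≡.sym (ℕ.+-suc ∣ p ∣ ∣ q ∣)))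
∣p∪q∣≤∣p∣+∣q∣ (inside ∷ p)  (outside ∷ q) = ℕ.s≤s (∣p∪q∣≤∣p∣+∣q∣ p q)
∣p∪q∣≤∣p∣+∣q∣ (inside ∷ p)  (inside ∷ q)  =
  ℕ.s≤s (ℕ.≤-trans (∣p∪q∣≤∣p∣+∣q∣ p q) (ℕ.+-monoʳ-≤ ∣ p ∣ (ℕ.n≤1+n ∣ q ∣)))

∣⁅x⁆∪p∣≤1+∣p∣ : ∀ {n} (x : Fin n) p → ∣ ⁅ x ⁆ ∪ p ∣ ℕ.≤ 1 ℕ.+ ∣ p ∣
∣⁅x⁆∪p∣≤1+∣p∣ x p =
  ℕ.≤-trans (∣p∪q∣≤∣p∣+∣q∣ ⁅ x ⁆ p) (ℕ.≤-reflexive (≡.cong (ℕ._+ ∣ p ∣) (∣⁅x⁆∣≡1 x)))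

-- The first components of `xs` form a set that gains at most one element per entry. This bounds the
-- missing vertices of `M` by the length of `I`.
∣p∣≤length : ∀ {a n} {A : Set a} {p : Subset n} (xs : List (Fin n × A)) →
             (∀ {u} → u ∈ₛ p → ∃ λ r → (u , r) ∈ xs) → ∣ p ∣ ℕ.≤ length xs
∣p∣≤length {n = n} {A} xs p⊆xs =
  ℕ.≤-trans (p⊆q⇒∣p∣≤∣q∣ (λ u∈p → ∈-verts (proj₂ (p⊆xs u∈p)))) (∣verts∣≤length xs)
  where
  verts : List (Fin n × A) → Subset n
  verts []             = ⊥
  verts ((u , _) ∷ xs) = ⁅ u ⁆ ∪ verts xs

  ∈-verts : ∀ {u r xs} → (u , r) ∈ xs → u ∈ₛ verts xs
  ∈-verts (here refl) = x∈p∪q⁺ (inj₁ (x∈⁅x⁆ _))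
  ∈-verts (there u∈)  = x∈p∪q⁺ (inj₂ (∈-verts u∈))

  ∣verts∣≤length : ∀ xs → ∣ verts xs ∣ ℕ.≤ length xs
  ∣verts∣≤length []             = ℕ.≤-reflexive (∣⊥∣≡0 n)
  ∣verts∣≤length ((u , _) ∷ xs) = ℕ.≤-trans (∣⁅x⁆∪p∣≤1+∣p∣ u (verts xs)) (ℕ.s≤s (∣verts∣≤length xs))

max-∈ : ∀ {n} (C : Subset n) {m} → max C ≡ just m → m ∈ₛ C
max-∈ (s ∷ C) eq with max C in eq′
max-∈ (s ∷ C)      refl | just m  = there (max-∈ C eq′)
max-∈ (inside ∷ C) refl | nothing = here

max-unique : ∀ {n} (C : Subset n) {m} → m ∈ₛ C → (∀ {c} → c ∈ₛ C → c Fin.≤ m) → max C ≡ just m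
max-unique C m∈C C≤m with max C in eq
... | nothing = contradiction eq (max-nonempty m∈C)
... | just m′ = ≡.cong just (Fin.≤-antisym (C≤m (max-∈ C eq)) (max-upper m∈C eq))

-- Vertices join `C` in increasing order, so the maximum used by `generateI` and `generateX` is the
-- vertex just added.
max-∪⁅⁆ : ∀ {n} (C : Subset n) {m} → (∀ {c} → c ∈ₛ C → c Fin.< m) → max (C ∪ ⁅ m ⁆) ≡ just m
max-∪⁅⁆ C {m} C<m = max-unique (C ∪ ⁅ m ⁆) (q⊆p∪q C ⁅ m ⁆ (x∈⁅x⁆ m)) λ c∈ →
  [ ℕ.<⇒≤ ∘ C<m , ℕ.≤-reflexive ∘ ≡.cong toℕ ∘ x∈⁅y⁆⇒x≡y m ]′ (x∈p∪q⁻ C ⁅ m ⁆ c∈)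

-- Yields the next vertex of `M` to be added. The search function states minimality over
-- `Fin (toℕ m)`, hence the transport through `fromℕ<`.
least : ∀ {n ℓ} {P : Pred (Fin n) ℓ} → Decidable P → ¬ (∀ i → P i) →
        ∃ λ m → ¬ P m × (∀ {j} → ¬ P j → m Fin.≤ j)
least {P = P} P? ¬∀P with Fin.¬∀⟶∃¬-smallest _ P P? ¬∀P
... | m , ¬Pm , below = m , ¬Pm , λ {j} ¬Pj → ℕ.≮⇒≥ λ j<m →
  ¬Pj (≡.subst P (Fin.toℕ-injective (≡.trans (Fin.toℕ-inject _) (Fin.toℕ-fromℕ< j<m)))
                 (below (Fin.fromℕ< j<m)))

lookup-injective : ∀ {a} {A : Set a} {xs : List A} → Unique xs →
                   ∀ {i j} → List.lookup xs i ≡ List.lookup xs j → i ≡ j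
lookup-injective {xs = _ ∷ _} _          {zero}  {zero}  _  = refl
lookup-injective {xs = _ ∷ _} (x∉ ∷ _)   {zero}  {suc j} eq = contradiction eq (All.lookup x∉ (∈-lookup j))
lookup-injective {xs = _ ∷ _} (x∉ ∷ _)   {suc i} {zero}  eq = contradiction (≡.sym eq) (All.lookup x∉ (∈-lookup i))
lookup-injective {xs = _ ∷ _} (_ ∷ uniq) {suc i} {suc j} eq = ≡.cong suc (lookup-injective uniq eq)

-- Pruning

module _ {n : ℕ} (t : ℕ) where
  open Pruning {n} t

  private
    -- These tests repeat those inside `dropEdges` and `dropVertices`, so that `∈-select⁺` and
    -- `∈-select⁻` can be given them explicitly.
    keepEdge? : ∀ (Γ : Fin n → Subset n) u v → Dec (v ∈ₛ Γ u × t ∸ 2 ℕ.≤ ∣ Γ u ∩ Γ v ∣)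
    keepEdge? Γ u v = v ∈? Γ u ×-dec t ∸ 2 ℕ.≤? ∣ Γ u ∩ Γ v ∣

    heavyNeighbour? : ∀ (Γ : Fin n → Subset n) v u → Dec (u ∈ₛ Γ v × t ∸ 2 ℕ.≤ ∣ Γ u ∩ Γ v ∣)
    heavyNeighbour? Γ v u = u ∈? Γ v ×-dec t ∸ 2 ℕ.≤? ∣ Γ u ∩ Γ v ∣

    keepVertex? : ∀ V (Γ : Fin n → Subset n) v → Dec (v ∈ₛ V × t ∸ 1 ℕ.≤ ∣ select (heavyNeighbour? Γ v) ∣)
    keepVertex? V Γ v = v ∈? V ×-dec t ∸ 1 ℕ.≤? ∣ select (heavyNeighbour? Γ v) ∣

  module _ (M : Subset n) (t≤∣M∣ : t ℕ.≤ ∣ M ∣) where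

    Contains : Graph n → Set
    Contains (graph V Γ) = M ⊆ₛ V × Complete Γ M

    -- Every vertex of `M` is `u`, `v` or a common neighbour of both, so `∣ M ∣` exceeds the number
    -- of common neighbours by at most two.
    common-neighbours : ∀ {Γ u v} → Complete Γ M → u ∈ₛ M → v ∈ₛ M → t ∸ 2 ℕ.≤ ∣ Γ u ∩ Γ v ∣
    common-neighbours {Γ} {u} {v} M-complete u∈M v∈M = ℕ.m≤n+o⇒m∸n≤o t 2
      (ℕ.≤-trans t≤∣M∣ (ℕ.≤-trans (p⊆q⇒∣p∣≤∣q∣ M⊆)
        (ℕ.≤-trans (∣⁅x⁆∪p∣≤1+∣p∣ u _) (ℕ.s≤s (∣⁅x⁆∪p∣≤1+∣p∣ v _)))))
      where
      M⊆ : M ⊆ₛ ⁅ u ⁆ ∪ (⁅ v ⁆ ∪ (Γ u ∩ Γ v))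
      M⊆ {w} w∈M with u Fin.≟ w | v Fin.≟ w
      ... | yes refl | _        = x∈p∪q⁺ (inj₁ (x∈⁅x⁆ u))
      ... | no _     | yes refl = x∈p∪q⁺ (inj₂ (x∈p∪q⁺ (inj₁ (x∈⁅x⁆ v))))
      ... | no u≢w   | no v≢w   = x∈p∪q⁺ (inj₂ (x∈p∪q⁺ (inj₂
        (x∈p∩q⁺ (M-complete u∈M w∈M u≢w , M-complete v∈M w∈M v≢w)))))

    dropEdges-Contains : ∀ g → Contains g → Contains (dropEdges g)
    dropEdges-Contains (graph V Γ) (M⊆V , M-complete) =
      M⊆V , λ {u} u∈M v∈M u≢v → ∈-select⁺ (keepEdge? Γ u)
        (M-complete u∈M v∈M u≢v , common-neighbours M-complete u∈M v∈M)

    -- For `v` in `M`, all other vertices of `M` count towards the bound `t ∸ 1`, by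
    -- `common-neighbours`. So all of `M` stays, and its edges with it.
    dropVertices-Contains : ∀ g → Contains g → Contains (dropVertices g)
    dropVertices-Contains g@(graph V Γ) (M⊆V , M-complete) = M⊆V′ , M-complete′
      where
      M⊆V′ : M ⊆ₛ Graph.V (dropVertices g)
      M⊆V′ {v} v∈M = ∈-select⁺ (keepVertex? V Γ) (M⊆V v∈M , ℕ.m≤n+o⇒m∸n≤o t 1
        (ℕ.≤-trans t≤∣M∣ (ℕ.≤-trans (p⊆q⇒∣p∣≤∣q∣ M⊆) (∣⁅x⁆∪p∣≤1+∣p∣ v _))))
        where
        M⊆ : M ⊆ₛ ⁅ v ⁆ ∪ select (heavyNeighbour? Γ v)
        M⊆ {u} u∈M with v Fin.≟ u
        ... | yes refl = x∈p∪q⁺ (inj₁ (x∈⁅x⁆ v))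
        ... | no v≢u   = x∈p∪q⁺ (inj₂ (∈-select⁺ (heavyNeighbour? Γ v)
          (M-complete v∈M u∈M v≢u , common-neighbours M-complete u∈M v∈M)))

      M-complete′ : Complete (Graph.Γ (dropVertices g)) M
      M-complete′ {u} u∈M v∈M u≢v with u ∈? Graph.V (dropVertices g)
      ... | yes _   = x∈p∩q⁺ (M-complete u∈M v∈M u≢v , M⊆V′ v∈M)
      ... | no u∉V′ = contradiction (M⊆V′ u∈M) u∉V′

  dropEdges-⊆ : ∀ g {u} → Graph.Γ (dropEdges g) u ⊆ₛ Graph.Γ g u
  dropEdges-⊆ (graph V Γ) {u} = proj₁ ∘ ∈-select⁻ (keepEdge? Γ u)

  dropVertices-⊆ : ∀ g {u} → Graph.Γ (dropVertices g) u ⊆ₛ Graph.Γ g u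
  dropVertices-⊆ g@(graph V Γ) {u} v∈ with u ∈? Graph.V (dropVertices g)
  ... | yes _ = p∩q⊆p _ _ v∈
  ... | no _  = contradiction v∈ ∉⊥

  -- Induction along the rounds, generalised over the accessibility proof on which `pruneAcc`
  -- recurses.
  prune-preserves : ∀ {ℓ} (P : Graph n → Set ℓ) → (∀ g → P g → P (round g)) → ∀ g → P g → P (prune g)
  prune-preserves P P-round g = go g (<-wellFounded (size g))
    where
    go : ∀ g (a : Acc ℕ._<_ (size g)) → P g → P (pruneAcc g a)
    go g (acc rs) Pg with size (round g) ℕ.<? size g
    ... | yes smaller = go (round g) (rs smaller) (P-round g Pg)
    ... | no _        = Pg

  -- Helps to bring adjacency in the pruned graph back to `𝒢`, where the properties of `p` are
  -- given.
  prune-⊆ : ∀ g {u} → Graph.Γ (prune g) u ⊆ₛ Graph.Γ g u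
  prune-⊆ g = prune-preserves (λ h → ∀ {u} → Graph.Γ h u ⊆ₛ Graph.Γ g u)
    (λ h h⊆g → h⊆g ∘ dropEdges-⊆ h ∘ dropVertices-⊆ (dropEdges h)) g id

  prune-Contains : ∀ M (t≤∣M∣ : t ℕ.≤ ∣ M ∣) g → Contains M t≤∣M∣ g → Contains M t≤∣M∣ (prune g)
  prune-Contains M t≤∣M∣ = prune-preserves (Contains M t≤∣M∣) λ g →
    dropVertices-Contains M t≤∣M∣ (dropEdges g) ∘ dropEdges-Contains M t≤∣M∣ g

-- The motive is explicit, so a goal about an `if` is split without abstracting the decision by
-- `with`.
if-elim : ∀ {ℓ ℓ′ a} {P : Set ℓ} {A : Set a} (d : Dec P) (Q : A → Set ℓ′) {x y} →
          (P → Q x) → (¬ P → Q y) → Q (if does d then x else y)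
if-elim (yes p) Q f g = f p
if-elim (no ¬p) Q f g = g ¬p

-- Products in an ordered commutative ring

module OrderedRingProperties {c ℓ₁ ℓ₂} (K : OrderedCommutativeRing c ℓ₁ ℓ₂) where
  open OrderedCommutativeRing K hiding (zero) renaming (refl to ≈-refl; sym to ≈-sym; trans to ≈-trans)
  open Sum *-commutativeMonoid public using ()
    renaming (sum to ∏; sum-cong-≋ to ∏-cong; ∑-distrib-+ to ∏-distrib-*; ∑-comm to ∏-comm;
              sum-replicate-zero to ∏-1)

  ≤-poset : Poset c ℓ₁ ℓ₂
  ≤-poset = record { isPartialOrder = IsDecTotalOrder.isPartialOrder isDecTotalOrder }

  open Poset ≤-poset public using ()
    renaming (refl to ≤-refl; reflexive to ≤-reflexive; trans to ≤-trans;
              antisym to ≤-antisym; ≤-respʳ-≈ to ≤-respʳ; ≤-respˡ-≈ to ≤-respˡ)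

  -- The order axioms speak of translations and nonnegative products, so the claim is obtained from
  -- `0# ≤ (y - x) * z` by adding `x * z`.
  *-monoˡ-≤ : ∀ {x y z} → 0# ≤ z → x ≤ y → x * z ≤ y * z
  *-monoˡ-≤ {x} {y} {z} 0≤z x≤y = begin
    x * z                 ≈⟨ +-identityˡ (x * z) ⟨
    0# + x * z            ≤⟨ +-monoˡ-≤ (x * z) (*-nonNeg 0≤y-x 0≤z) ⟩
    (y - x) * z + x * z   ≈⟨ distribʳ z (y - x) x ⟨
    (y - x + x) * z       ≈⟨ *-congʳ (+-assoc y (- x) x) ⟩
    (y + (- x + x)) * z   ≈⟨ *-congʳ (+-congˡ (-‿inverseˡ x)) ⟩
    (y + 0#) * z          ≈⟨ *-congʳ (+-identityʳ y) ⟩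
    y * z                 ∎
    where
    open ≤-Reasoning ≤-poset
    0≤y-x : 0# ≤ y - x
    0≤y-x = ≤-respˡ (-‿inverseʳ x) (+-monoˡ-≤ (- x) x≤y)

  *-mono-≤ : ∀ {x y z w} → 0# ≤ y → 0# ≤ z → x ≤ y → z ≤ w → x * z ≤ y * w
  *-mono-≤ {x} {y} {z} {w} 0≤y 0≤z x≤y z≤w = begin
    x * z ≤⟨ *-monoˡ-≤ 0≤z x≤y ⟩
    y * z ≈⟨ *-comm y z ⟩
    z * y ≤⟨ *-monoˡ-≤ 0≤y z≤w ⟩
    w * y ≈⟨ *-comm w y ⟩
    y * w ∎
    where open ≤-Reasoning ≤-poset

  module _ (0≤1 : 0# ≤ 1#) where

    ∏-nonNeg : ∀ {m} {f : Fin m → Carrier} → (∀ i → 0# ≤ f i) → 0# ≤ ∏ f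
    ∏-nonNeg {ℕ.zero}  0≤f = 0≤1
    ∏-nonNeg {ℕ.suc m} 0≤f = *-nonNeg (0≤f zero) (∏-nonNeg (0≤f ∘ suc))

    ∏-mono-≤ : ∀ {m} {f g : Fin m → Carrier} → (∀ i → 0# ≤ f i) → (∀ i → f i ≤ g i) → ∏ f ≤ ∏ g
    ∏-mono-≤ {ℕ.zero}  0≤f f≤g = ≤-refl
    ∏-mono-≤ {ℕ.suc m} 0≤f f≤g =
      *-mono-≤ (≤-trans (0≤f zero) (f≤g zero)) (∏-nonNeg (0≤f ∘ suc))
               (f≤g zero) (∏-mono-≤ (0≤f ∘ suc) (f≤g ∘ suc))

  ∏≈1 : ∀ {m} {f : Fin m → Carrier} → (∀ i → f i ≈ 1#) → ∏ f ≈ 1#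
  ∏≈1 {m} f≈1 = ≈-trans (∏-cong f≈1) (∏-1 m)

  ∏≈0 : ∀ {m} {f : Fin m → Carrier} i → f i ≈ 0# → ∏ f ≈ 0#
  ∏≈0 zero    f≈0 = ≈-trans (*-congʳ f≈0) (zeroˡ _)
  ∏≈0 (suc i) f≈0 = ≈-trans (*-congˡ (∏≈0 i f≈0)) (zeroʳ _)

  -- Neutral when the condition fails, so that products over a set or its pairs become products over
  -- all indices.
  when : ∀ {ℓ} {P : Set ℓ} → Dec P → Carrier → Carrier
  when d x = if does d then x else 1#

  if-≈ : ∀ {ℓ} {P : Set ℓ} (d : Dec P) {x y z : Carrier} →
         (P → x ≈ z) → (¬ P → y ≈ z) → (if does d then x else y) ≈ z
  if-≈ d = if-elim d (_≈ _)

  when-yes : ∀ {ℓ} {P : Set ℓ} (d : Dec P) {x} → P → when d x ≈ x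
  when-yes d p = if-≈ d (λ _ → ≈-refl) (contradiction p)

  when-no : ∀ {ℓ} {P : Set ℓ} (d : Dec P) {x} → ¬ P → when d x ≈ 1#
  when-no d ¬p = if-≈ d (λ p → contradiction p ¬p) (λ _ → ≈-refl)

  when-⇔ : ∀ {ℓ ℓ′} {P : Set ℓ} {Q : Set ℓ′} (d : Dec P) (e : Dec Q) {x y} →
           (P → Q) → (Q → P) → (P → x ≈ y) → when d x ≈ when e y
  when-⇔ d e P⇒Q Q⇒P x≈y = if-≈ d
    (λ p → ≈-trans (x≈y p) (≈-sym (when-yes e (P⇒Q p))))
    (λ ¬p → ≈-sym (when-no e (¬p ∘ Q⇒P)))

  -- The marginal of one edge: if it must be present, only `x` is left; if not, the two outcomes add
  -- up to `1#`.
  if-complement : ∀ {ℓ} {P : Set ℓ} (d : Dec P) x → x + (if does d then 0# else 1# - x) ≈ when d x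
  if-complement (yes _) x = +-identityʳ x
  if-complement (no _)  x = begin
    x + (1# - x)   ≈⟨ +-congˡ (+-comm 1# (- x)) ⟩
    x + (- x + 1#) ≈⟨ +-assoc x (- x) 1# ⟨
    x - x + 1#     ≈⟨ +-congʳ (-‿inverseʳ x) ⟩
    0# + 1#        ≈⟨ +-identityˡ 1# ⟩
    1#             ∎
    where open ≈-Reasoning setoid

  ∏-single : ∀ {m} (j : Fin m) (f : Fin m → Carrier) → ∏ (λ i → when (i Fin.≟ j) (f i)) ≈ f j
  ∏-single {ℕ.suc m} zero    f = ≈-trans (*-congˡ (∏-1 m)) (*-identityʳ (f zero))
  ∏-single {ℕ.suc m} (suc j) f = ≈-trans (*-identityˡ _) (≈-trans
    (∏-cong λ i → when-⇔ (suc i Fin.≟ suc j) (i Fin.≟ j) Fin.suc-injective (≡.cong suc) λ _ → ≈-refl)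
    (∏-single j (f ∘ suc)))

  -- Defined through `List.lookup` so that products over the indices of `edges` are instances by
  -- definition.
  ∏ₗ : ∀ {a} {A : Set a} → List A → (A → Carrier) → Carrier
  ∏ₗ xs f = ∏ (f ∘ List.lookup xs)

  ∏ₗ-++ : ∀ {a} {A : Set a} (xs ys : List A) (f : A → Carrier) → ∏ₗ (xs ++ ys) f ≈ ∏ₗ xs f * ∏ₗ ys f
  ∏ₗ-++ []       ys f = ≈-sym (*-identityˡ _)
  ∏ₗ-++ (x ∷ xs) ys f = ≈-trans (*-congˡ (∏ₗ-++ xs ys f)) (≈-sym (*-assoc _ _ _))

  ∏ₗ-map : ∀ {a b} {A : Set a} {B : Set b} (g : A → B) xs (f : B → Carrier) →
           ∏ₗ (map g xs) f ≈ ∏ₗ xs (f ∘ g)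
  ∏ₗ-map g []       f = ≈-refl
  ∏ₗ-map g (x ∷ xs) f = *-congˡ (∏ₗ-map g xs f)

  ∏ₗ-filter : ∀ {a ℓ} {A : Set a} {P : Pred A ℓ} (P? : Decidable P) xs (f : A → Carrier) →
              ∏ₗ (filter P? xs) f ≈ ∏ₗ xs (λ x → when (P? x) (f x))
  ∏ₗ-filter P? []       f = ≈-refl
  ∏ₗ-filter P? (x ∷ xs) f with P? x
  ... | yes _ = *-congˡ (∏ₗ-filter P? xs f)
  ... | no _  = ≈-trans (∏ₗ-filter P? xs f) (≈-sym (*-identityˡ _))

  ∏ₗ-tabulate : ∀ {a m} {A : Set a} (g : Fin m → A) (f : A → Carrier) →
                ∏ₗ (List.tabulate g) f ≈ ∏ (f ∘ g)
  ∏ₗ-tabulate {m = ℕ.zero}  g f = ≈-refl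
  ∏ₗ-tabulate {m = ℕ.suc m} g f = *-congˡ (∏ₗ-tabulate (g ∘ suc) f)

  ∏ₗ-cartesianProduct : ∀ {a b} {A : Set a} {B : Set b} (xs : List A) (ys : List B) f →
    ∏ₗ (cartesianProduct xs ys) f ≈ ∏ₗ xs (λ x → ∏ₗ ys (λ y → f (x , y)))
  ∏ₗ-cartesianProduct []       ys f = ≈-refl
  ∏ₗ-cartesianProduct (x ∷ xs) ys f = ≈-trans (∏ₗ-++ (map (x ,_) ys) _ f)
    (*-cong (∏ₗ-map (x ,_) ys f) (∏ₗ-cartesianProduct xs ys f))

-- The clique probability as a product over pairs

module CliqueProbability {c ℓ₁ ℓ₂} {K : OrderedCommutativeRing c ℓ₁ ℓ₂} {n : ℕ}
                         (𝒢 : UncertainGraph K n) where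
  open OrderedCommutativeRing K hiding (zero) renaming (refl to ≈-refl; sym to ≈-sym; trans to ≈-trans)
  open OrderedRingProperties K
  open UncertainGraph 𝒢
  open Cliques 𝒢 hiding (∏)

  private
    pᵉ : Fin n × Fin n → Carrier
    pᵉ (u , v) = p u v

    both? : ∀ C (e : Fin n × Fin n) → Dec (proj₁ e ∈ₛ C × proj₂ e ∈ₛ C)
    both? C (u , v) = u ∈? C ×-dec v ∈? C

    pair? : ∀ C u v → Dec (u Fin.< v × u ∈ₛ C × v ∈ₛ C)
    pair? C u v = u Fin.<? v ×-dec both? C (u , v)

  -- Each unordered pair is counted once, with its smaller vertex first.
  weight : Subset n → Carrier
  weight C = ∏ λ u → ∏ λ v → when (pair? C u v) (p u v)

  -- The factor by which the weight changes when an outside vertex `u` joins `C`; it is the number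
  -- paired with `u` in `I` and `X`.
  extension : Fin n → Subset n → Carrier
  extension u C = ∏ λ v → when (v ∈? C) (p u v)

  ∑-cong : ∀ {m} {f g : Subset m → Carrier} → (∀ W → f W ≈ g W) → ∑ f ≈ ∑ g
  ∑-cong {ℕ.zero}  f≈g = f≈g []
  ∑-cong {ℕ.suc m} f≈g = +-cong (∑-cong (f≈g ∘ (inside ∷_))) (∑-cong (f≈g ∘ (outside ∷_)))

  ∑-distribˡ : ∀ {m} x (f : Subset m → Carrier) → ∑ (λ W → x * f W) ≈ x * ∑ f
  ∑-distribˡ {ℕ.zero}  x f = ≈-refl
  ∑-distribˡ {ℕ.suc m} x f = ≈-trans
    (+-cong (∑-distribˡ x (f ∘ (inside ∷_))) (∑-distribˡ x (f ∘ (outside ∷_))))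
    (≈-sym (distribˡ x _ _))

  ∑-zero : ∀ {m} {f : Subset m → Carrier} → (∀ W → f W ≈ 0#) → ∑ f ≈ 0#
  ∑-zero {ℕ.zero}  f≈0 = f≈0 []
  ∑-zero {ℕ.suc m} f≈0 = ≈-trans
    (+-cong (∑-zero (f≈0 ∘ (inside ∷_))) (∑-zero (f≈0 ∘ (outside ∷_)))) (+-identityˡ 0#)

  -- Independence of the edges: when the product on the right is expanded, each `W` picks one
  -- summand per index.
  ∑-∏-distrib : ∀ {m} (g : Fin m → Bool → Carrier) →
                ∑ (λ W → ∏ λ i → g i (does (i ∈? W))) ≈ ∏ (λ i → g i true + g i false)
  ∑-∏-distrib {ℕ.zero}  g = ≈-refl
  ∑-∏-distrib {ℕ.suc m} g = ≈-trans
    (+-cong (≈-trans (∑-distribˡ (g zero true) rest) (*-congˡ (∑-∏-distrib (g ∘ suc))))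
            (≈-trans (∑-distribˡ (g zero false) rest) (*-congˡ (∑-∏-distrib (g ∘ suc)))))
    (≈-sym (distribʳ _ (g zero true) (g zero false)))
    where
    rest : Subset m → Carrier
    rest W = ∏ λ i → g (suc i) (does (i ∈? W))

  private
    edge : Fin (length edges) → Fin n × Fin n
    edge = List.lookup edges

  edges-unique : Unique edges
  edges-unique = Unique.filter⁺ _ (Unique.cartesianProduct⁺ (Unique.allFin⁺ n) (Unique.allFin⁺ n))

  edge⁻ : ∀ i → proj₁ (edge i) Fin.< proj₂ (edge i) × proj₂ (edge i) ∈ₛ Γ (proj₁ (edge i))
  edge⁻ i = proj₂ (∈-filter⁻ _ {xs = cartesianProduct (allFin n) (allFin n)} (∈-lookup i))

  edge⁺ : ∀ {u v} → u Fin.< v → v ∈ₛ Γ u → ∃ λ i → edge i ≡ (u , v)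
  edge⁺ u<v v∈Γu = Any.index uv∈edges , ≡.sym (lookup-index uv∈edges)
    where uv∈edges = ∈-filter⁺ _ (∈-cartesianProduct⁺ (∈-allFin _) (∈-allFin _)) (u<v , v∈Γu)

  -- A condition on each coordinate of `W` separately, so its indicator is a product. It ignores
  -- nonadjacent pairs of `C`, which is why the passage back to `IsClique` assumes completeness.
  ContainsEdges : Subset n → World → Set
  ContainsEdges C W = ∀ i → proj₁ (edge i) ∈ₛ C × proj₂ (edge i) ∈ₛ C → i ∈ₛ W

  IsClique⇒ContainsEdges : ∀ {C W} → IsClique C W → ContainsEdges C W
  IsClique⇒ContainsEdges {W = W} clique i (u∈C , v∈C)
    with clique _ _ u∈C v∈C (Fin.<⇒≢ (proj₁ (edge⁻ i)))
  ... | j , j∈W , inj₁ eq = ≡.subst (_∈ₛ W) (lookup-injective edges-unique eq) j∈W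
  -- `edges` lists every pair with its smaller vertex first, so a reversed copy cannot occur.
  ... | j , j∈W , inj₂ eq = contradiction (proj₁ (edge⁻ i))
    (Fin.<-asym (≡.subst (uncurry Fin._<_) eq (proj₁ (edge⁻ j))))

  ContainsEdges⇒IsClique : ∀ {C W} → Complete Γ C → ContainsEdges C W → IsClique C W
  ContainsEdges⇒IsClique {C} {W} complete contains u v u∈C v∈C u≢v with Fin.<-cmp u v
  ... | tri≈ _ u≡v _ = contradiction u≡v u≢v
  ... | tri< u<v _ _ with edge⁺ u<v (complete u∈C v∈C u≢v)
  ...   | i , refl = i , contains i (u∈C , v∈C) , inj₁ refl
  ContainsEdges⇒IsClique {C} {W} complete contains u v u∈C v∈C u≢v | tri> _ _ v<u
    with edge⁺ v<u (complete v∈C u∈C (u≢v ∘ ≡.sym))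
  ... | i , refl = i , contains i (v∈C , u∈C) , inj₂ refl

  IsClique⇒Complete : ∀ {C W} → IsClique C W → Complete Γ C
  IsClique⇒Complete clique {u} {v} u∈C v∈C u≢v with clique u v u∈C v∈C u≢v
  ... | i , _ , inj₁ refl = proj₂ (edge⁻ i)
  ... | i , _ , inj₂ refl = Γ-sym (proj₂ (edge⁻ i))

  -- Multiplying `prob W` by the clique indicator amounts to replacing the factor of each unsampled
  -- edge inside `C` by `0#`. The sum over worlds then factorises.
  clq≈∏ : ∀ {C} → Complete Γ C → clq C ≈ ∏ (λ i → when (both? C (edge i)) (pᵉ (edge i)))
  clq≈∏ {C} complete = ≈-trans (∑-cong indicator) (≈-trans (∑-∏-distrib factor) (∏-cong marginal))
    where
    factor : Fin (length edges) → Bool → Carrier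
    factor i true  = pᵉ (edge i)
    factor i false = if does (both? C (edge i)) then 0# else 1# - pᵉ (edge i)

    marginal : ∀ i → factor i true + factor i false ≈ when (both? C (edge i)) (pᵉ (edge i))
    marginal i = if-complement (both? C (edge i)) (pᵉ (edge i))

    indicator : ∀ W → (if does (isClique? C W) then prob W else 0#) ≈ ∏ (λ i → factor i (does (i ∈? W)))
    indicator W = if-≈ (isClique? C W) (λ clique → ∏-cong (inside-clique clique)) outside-clique
      where
      inside-clique : IsClique C W → ∀ i →
        (if does (i ∈? W) then pᵉ (edge i) else 1# - pᵉ (edge i)) ≈ factor i (does (i ∈? W))
      inside-clique clique i with i ∈? W
      ... | yes _  = ≈-refl
      ... | no i∉W = ≈-sym (if-≈ (both? C (edge i))
        (λ both → contradiction (IsClique⇒ContainsEdges clique i both) i∉W) (λ _ → ≈-refl))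

      outside-clique : ¬ IsClique C W → 0# ≈ ∏ (λ i → factor i (does (i ∈? W)))
      -- Containment of the edges is decidable over finitely many indices, so a missing edge can be
      -- exhibited; its factor makes the product vanish.
      outside-clique ¬clique
        with Fin.¬∀⟶∃¬ _ _ (λ i → both? C (edge i) →-dec i ∈? W)
               (¬clique ∘ ContainsEdges⇒IsClique complete)
      ... | i , ¬contains = ≈-sym (∏≈0 i vanishes)
        where
        vanishes : factor i (does (i ∈? W)) ≈ 0#
        vanishes with i ∈? W
        ... | yes i∈W = contradiction (λ _ → i∈W) ¬contains
        ... | no _    = if-≈ (both? C (edge i)) (λ _ → ≈-refl)
          λ ¬both → contradiction (λ both → contradiction both ¬both) ¬contains

  -- Reindexing: the filter defining `edges` becomes an outer `when`, and completeness absorbs the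
  -- edge test for pairs inside `C`.
  clq≈weight : ∀ {C} → Complete Γ C → clq C ≈ weight C
  clq≈weight {C} complete = begin
    clq C
      ≈⟨ clq≈∏ complete ⟩
    ∏ₗ edges (λ e → when (both? C e) (pᵉ e))
      ≈⟨ ∏ₗ-filter (uncurry isEdge?) (cartesianProduct (allFin n) (allFin n)) (λ e → when (both? C e) (pᵉ e)) ⟩
    ∏ₗ (cartesianProduct (allFin n) (allFin n)) f
      ≈⟨ ∏ₗ-cartesianProduct (allFin n) (allFin n) f ⟩
    ∏ₗ (allFin n) (λ u → ∏ₗ (allFin n) λ v → f (u , v))
      ≈⟨ ∏ₗ-tabulate id (λ u → ∏ₗ (allFin n) λ v → f (u , v)) ⟩
    ∏ (λ u → ∏ₗ (allFin n) λ v → f (u , v))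
      ≈⟨ ∏-cong (λ u → ≈-trans (∏ₗ-tabulate id (λ v → f (u , v))) (∏-cong (f≈ u))) ⟩
    weight C
      ∎
    where
    open ≈-Reasoning setoid
    isEdge? : ∀ u v → Dec (u Fin.< v × v ∈ₛ Γ u)
    isEdge? u v = u Fin.<? v ×-dec v ∈? Γ u
    f : Fin n × Fin n → Carrier
    f (u , v) = when (isEdge? u v) (when (both? C (u , v)) (p u v))
    f≈ : ∀ u v → f (u , v) ≈ when (pair? C u v) (p u v)
    f≈ u v = if-≈ (isEdge? u v)
      (λ (u<v , _) → when-⇔ (both? C (u , v)) (pair? C u v)
        (u<v ,_) proj₂ (λ _ → ≈-refl))
      λ ¬edge → ≈-sym (when-no (pair? C u v)
        λ (u<v , u∈C , v∈C) → ¬edge (u<v , complete u∈C v∈C (Fin.<⇒≢ u<v)))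

  -- If two vertices of `C` were not adjacent, no world would make `C` a clique, so `clq C` would be
  -- zero, contrary to `0# < α`.
  αClique-complete : ∀ {α C} → 0# < α → IsαClique α C → Complete Γ C
  αClique-complete {C = C} (0≤α , 0≉α) α≤clq {u} {v} u∈C v∈C u≢v = decidable-stable (v ∈? Γ u) λ v∉Γu →
    0≉α (≤-antisym 0≤α (≤-respʳ (∑-zero λ W → if-≈ (isClique? C W)
      (λ clique → contradiction (IsClique⇒Complete clique u∈C v∈C u≢v) v∉Γu)
      (λ _ → ≈-refl)) α≤clq))

  weight-⊥ : weight ⊥ ≈ 1#
  weight-⊥ = ∏≈1 {n} λ u → ∏≈1 {n} λ v → when-no (pair? ⊥ u v) (∉⊥ ∘ proj₁ ∘ proj₂)

  weight-⁅⁆ : ∀ u → weight ⁅ u ⁆ ≈ 1#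
  weight-⁅⁆ u = ∏≈1 {n} λ a → ∏≈1 {n} λ b → when-no (pair? ⁅ u ⁆ a b)
    λ (a<b , a∈ , b∈) → Fin.<⇒≢ a<b (≡.trans (x∈⁅y⁆⇒x≡y u a∈) (≡.sym (x∈⁅y⁆⇒x≡y u b∈)))

  extension-⊥ : ∀ u → extension u ⊥ ≈ 1#
  extension-⊥ u = ∏≈1 {n} λ v → when-no (v ∈? ⊥) ∉⊥

  extension-⁅⁆ : ∀ u v → extension u ⁅ v ⁆ ≈ p u v
  extension-⁅⁆ u v = ≈-trans
    (∏-cong λ w → when-⇔ (w ∈? ⁅ v ⁆) (w Fin.≟ v) (x∈⁅y⁆⇒x≡y v) (λ { refl → x∈⁅x⁆ v }) λ _ → ≈-refl)
    (∏-single v (p u))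

  -- Justifies the update `r * p u m` performed by `generateI` and `generateX` when `m` is added.
  extension-∪ : ∀ {C m} u → m ∉ₛ C → extension u (C ∪ ⁅ m ⁆) ≈ extension u C * p u m
  extension-∪ {C} {m} u m∉C = begin
    extension u (C ∪ ⁅ m ⁆)
      ≈⟨ ∏-cong split ⟩
    ∏ (λ v → when (v ∈? C) (p u v) * when (v Fin.≟ m) (p u v))
      ≈⟨ ∏-distrib-* (λ v → when (v ∈? C) (p u v)) _ ⟩
    extension u C * ∏ (λ v → when (v Fin.≟ m) (p u v))
      ≈⟨ *-congˡ (∏-single m (p u)) ⟩
    extension u C * p u m
      ∎
    where
    open ≈-Reasoning setoid
    split : ∀ v → when (v ∈? C ∪ ⁅ m ⁆) (p u v) ≈ when (v ∈? C) (p u v) * when (v Fin.≟ m) (p u v)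
    split v with v Fin.≟ m
    ... | yes refl = ≈-trans (when-yes (v ∈? C ∪ ⁅ v ⁆) (q⊆p∪q C ⁅ v ⁆ (x∈⁅x⁆ v)))
      (≈-sym (≈-trans (*-congʳ (when-no (v ∈? C) m∉C)) (*-identityˡ _)))
    ... | no v≢m = ≈-trans (when-⇔ (v ∈? C ∪ ⁅ m ⁆) (v ∈? C)
        ([ id , (λ v∈ → contradiction (x∈⁅y⁆⇒x≡y m v∈) v≢m) ]′ ∘ x∈p∪q⁻ C ⁅ m ⁆)
        (p⊆p∪q ⁅ m ⁆) λ _ → ≈-refl)
      (≈-sym (*-identityʳ _))

  -- A pair in `C ∪ ⁅ u ⁆` lies inside `C` or has `u` as its larger or smaller element. The last two
  -- kinds merge into `extension u C`; adjacency allows `p-sym` to reverse the pairs in which `u` is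
  -- larger.
  weight-∪ : ∀ {C u} → u ∉ₛ C → (∀ {c} → c ∈ₛ C → u ∈ₛ Γ c) →
             weight (C ∪ ⁅ u ⁆) ≈ weight C * extension u C
  weight-∪ {C} {u} u∉C adjacent = begin
    weight (C ∪ ⁅ u ⁆)
      ≈⟨ ∏-cong (λ a → ∏-cong (split a)) ⟩
    ∏ (λ a → ∏ λ b → F a b * (L a b * R a b))
      ≈⟨ ∏∏-distrib F _ ⟩
    weight C * ∏ (λ a → ∏ λ b → L a b * R a b)
      ≈⟨ *-congˡ (∏∏-distrib L R) ⟩
    weight C * (∏ (λ a → ∏ (L a)) * ∏ (λ a → ∏ (R a)))
      -- `L` selects the second index, so its inner product collapses at once; `R` selects the
      -- first, so its two products are exchanged before collapsing.
      ≈⟨ *-congˡ (*-cong (∏-cong λ a → ∏-single u (λ _ → below a)) (∏-comm R)) ⟩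
    weight C * (∏ below * ∏ (λ b → ∏ λ a → R a b))
      ≈⟨ *-congˡ (*-congˡ (∏-cong λ b → ∏-single u (λ _ → above b))) ⟩
    weight C * (∏ below * ∏ above)
      ≈⟨ *-congˡ (∏-distrib-* below above) ⟨
    weight C * ∏ (λ w → below w * above w)
      ≈⟨ *-congˡ (∏-cong merge) ⟩
    weight C * extension u C
      ∎
    where
    open ≈-Reasoning setoid

    below above : Fin n → Carrier
    below a = when (a Fin.<? u ×-dec a ∈? C) (p a u)
    above b = when (u Fin.<? b ×-dec b ∈? C) (p u b)

    -- F collects the pairs inside C, L and R those whose larger, resp. smaller, element is u.
    F L R : Fin n → Fin n → Carrier
    F a b = when (pair? C a b) (p a b)
    L a b = when (b Fin.≟ u) (below a)
    R a b = when (a Fin.≟ u) (above b)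

    ∏∏-distrib : (f g : Fin n → Fin n → Carrier) →
                 ∏ (λ a → ∏ λ b → f a b * g a b) ≈ ∏ (λ a → ∏ (f a)) * ∏ (λ a → ∏ (g a))
    ∏∏-distrib f g = ≈-trans (∏-cong λ a → ∏-distrib-* (f a) (g a)) (∏-distrib-* (λ a → ∏ (f a)) _)

    ∈∪⁻ : ∀ {w} → w ≢ u → w ∈ₛ C ∪ ⁅ u ⁆ → w ∈ₛ C
    ∈∪⁻ w≢u = [ id , (λ w∈ → contradiction (x∈⁅y⁆⇒x≡y u w∈) w≢u) ]′ ∘ x∈p∪q⁻ C ⁅ u ⁆

    C⊆ : C ⊆ₛ C ∪ ⁅ u ⁆
    C⊆ = p⊆p∪q ⁅ u ⁆

    u∈ : u ∈ₛ C ∪ ⁅ u ⁆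
    u∈ = q⊆p∪q C ⁅ u ⁆ (x∈⁅x⁆ u)

    split : ∀ a b → when (pair? (C ∪ ⁅ u ⁆) a b) (p a b) ≈ F a b * (L a b * R a b)
    split a b with a Fin.≟ u | b Fin.≟ u
    ... | yes refl | yes refl = ≈-trans (when-no (pair? (C ∪ ⁅ u ⁆) u u) (Fin.<-irrefl refl ∘ proj₁))
      (≈-sym (≈-trans
        (*-cong (when-no (pair? C u u) (u∉C ∘ proj₁ ∘ proj₂))
          (*-cong (when-no (u Fin.<? u ×-dec u ∈? C) (u∉C ∘ proj₂))
                  (when-no (u Fin.<? u ×-dec u ∈? C) (u∉C ∘ proj₂))))
        (≈-trans (*-identityˡ _) (*-identityˡ _))))
    ... | yes refl | no b≢u = ≈-trans
      (when-⇔ (pair? (C ∪ ⁅ u ⁆) u b) (u Fin.<? b ×-dec b ∈? C)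
        (λ (u<b , _ , b∈) → u<b , ∈∪⁻ b≢u b∈) (λ (u<b , b∈C) → u<b , u∈ , C⊆ b∈C) λ _ → ≈-refl)
      (≈-sym (≈-trans (*-cong (when-no (pair? C u b) (u∉C ∘ proj₁ ∘ proj₂)) (*-identityˡ _))
                      (*-identityˡ _)))
    ... | no a≢u | yes refl = ≈-trans
      (when-⇔ (pair? (C ∪ ⁅ u ⁆) a u) (a Fin.<? u ×-dec a ∈? C)
        (λ (a<u , a∈ , _) → a<u , ∈∪⁻ a≢u a∈) (λ (a<u , a∈C) → a<u , C⊆ a∈C , u∈) λ _ → ≈-refl)
      (≈-sym (≈-trans (*-cong (when-no (pair? C a u) (u∉C ∘ proj₂ ∘ proj₂)) (*-identityʳ _))
                      (*-identityˡ _)))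
    ... | no a≢u | no b≢u = ≈-trans
      (when-⇔ (pair? (C ∪ ⁅ u ⁆) a b) (pair? C a b)
        (λ (a<b , a∈ , b∈) → a<b , ∈∪⁻ a≢u a∈ , ∈∪⁻ b≢u b∈)
        (λ (a<b , a∈C , b∈C) → a<b , C⊆ a∈C , C⊆ b∈C) λ _ → ≈-refl)
      (≈-sym (≈-trans (*-congˡ (*-identityˡ 1#)) (*-identityʳ _)))

    merge : ∀ w → below w * above w ≈ when (w ∈? C) (p u w)
    merge w with Fin.<-cmp w u
    ... | tri≈ _ refl _ = ≈-trans
      (*-cong (when-no (w Fin.<? w ×-dec w ∈? C) (u∉C ∘ proj₂))
              (when-no (w Fin.<? w ×-dec w ∈? C) (u∉C ∘ proj₂)))
      (≈-trans (*-identityˡ 1#) (≈-sym (when-no (w ∈? C) u∉C)))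
    ... | tri< w<u _ u≮w = ≈-trans
      (*-congˡ (when-no (u Fin.<? w ×-dec w ∈? C) (u≮w ∘ proj₁)))
      (≈-trans (*-identityʳ _) (when-⇔ (w Fin.<? u ×-dec w ∈? C) (w ∈? C)
        proj₂ (w<u ,_) (p-sym ∘ adjacent ∘ proj₂)))
    ... | tri> w≮u _ u<w = ≈-trans
      (*-congʳ (when-no (w Fin.<? u ×-dec w ∈? C) (w≮u ∘ proj₁)))
      (≈-trans (*-identityˡ _) (when-⇔ (u Fin.<? w ×-dec w ∈? C) (w ∈? C)
        proj₂ (u<w ,_) λ _ → ≈-refl))

  module _ (0≤1 : 0# ≤ 1#) where

    -- Passing from `C` to `D` only adds factors, and by completeness of `D` these are edge
    -- probabilities, between `0#` and `1#`.
    weight-antitone : ∀ {C D} → Complete Γ D → C ⊆ₛ D → weight D ≤ weight C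
    weight-antitone {C} {D} complete C⊆D =
      ∏-mono-≤ 0≤1 (λ a → ∏-nonNeg 0≤1 (nonNeg a)) λ a → ∏-mono-≤ 0≤1 (nonNeg a) (mono a)
      where
      nonNeg : ∀ a b → 0# ≤ when (pair? D a b) (p a b)
      nonNeg a b = if-elim (pair? D a b) (0# ≤_)
        (λ (a<b , a∈D , b∈D) → proj₁ (p-pos (complete a∈D b∈D (Fin.<⇒≢ a<b)))) (λ _ → 0≤1)

      mono : ∀ a b → when (pair? D a b) (p a b) ≤ when (pair? C a b) (p a b)
      mono a b = if-elim (pair? C a b) (when (pair? D a b) (p a b) ≤_)
        (λ (a<b , a∈C , b∈C) → ≤-reflexive (when-yes (pair? D a b) (a<b , C⊆D a∈C , C⊆D b∈C)))
        λ _ → if-elim (pair? D a b) (_≤ 1#)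
          (λ (a<b , a∈D , b∈D) → p≤1 (complete a∈D b∈D (Fin.<⇒≢ a<b))) (λ _ → ≤-refl)

    -- Compare `C` with its two-element subset. Building that as `⁅ v ⁆ ∪ ⁅ u ⁆` gives `p u v`
    -- whichever vertex is smaller.
    weight≤p : ∀ {C} → Complete Γ C → ∀ {u v} → u ∈ₛ C → v ∈ₛ C → u ≢ v → weight C ≤ p u v
    weight≤p {C} complete {u} {v} u∈C v∈C u≢v = begin
      weight C                        ≤⟨ weight-antitone complete ⁅v⁆∪⁅u⁆⊆C ⟩
      weight (⁅ v ⁆ ∪ ⁅ u ⁆)          ≈⟨ weight-∪ (u≢v ∘ x∈⁅y⁆⇒x≡y v) adjacent ⟩
      weight ⁅ v ⁆ * extension u ⁅ v ⁆ ≈⟨ *-cong (weight-⁅⁆ v) (extension-⁅⁆ u v) ⟩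
      1# * p u v                      ≈⟨ *-identityˡ (p u v) ⟩
      p u v                           ∎
      where
      open ≤-Reasoning ≤-poset
      ⁅v⁆∪⁅u⁆⊆C : ⁅ v ⁆ ∪ ⁅ u ⁆ ⊆ₛ C
      ⁅v⁆∪⁅u⁆⊆C = ∪⁅⁆-⊆ (λ w∈⁅v⁆ → ≡.subst (_∈ₛ C) (≡.sym (x∈⁅y⁆⇒x≡y v w∈⁅v⁆)) v∈C) u∈C

      adjacent : ∀ {c} → c ∈ₛ ⁅ v ⁆ → u ∈ₛ Γ c
      adjacent c∈ with refl ← x∈⁅y⁆⇒x≡y v c∈ = Γ-sym (complete u∈C v∈C u≢v)

-- Enumeration

module _ {c ℓ₁ ℓ₂} {K : OrderedCommutativeRing c ℓ₁ ℓ₂} {n : ℕ} (𝒢 : UncertainGraph K n)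
         (α : OrderedCommutativeRing.Carrier K) (t : ℕ)
         (Γ′ : Fin n → Subset n) (Γ′⊆Γ : ∀ {u} → Γ′ u ⊆ₛ UncertainGraph.Γ 𝒢 u) where
  open OrderedCommutativeRing K hiding (zero) renaming (refl to ≈-refl; sym to ≈-sym; trans to ≈-trans)
  open OrderedRingProperties K
  open UncertainGraph 𝒢
  open Cliques 𝒢 hiding (∏)
  open CliqueProbability 𝒢
  open Enumeration K Γ′ p α t

  ∈-generateI⁺ : ∀ C {m q I u r} → max C ≡ just m → (u , r) ∈ I →
                 m Fin.< u → u ∈ₛ Γ′ m → α ≤ q * r * p u m → (u , r * p u m) ∈ generateI C q I
  ∈-generateI⁺ C eq ur∈I m<u u∈Γm α≤ with max C
  ∈-generateI⁺ C refl ur∈I m<u u∈Γm α≤ | just m = ∈-map⁺ _ (∈-filter⁺ _ ur∈I (m<u , u∈Γm , α≤))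

  ∈-generateI⁻ : ∀ C {m q I u r} → max C ≡ just m → (u , r) ∈ generateI C q I →
                 ∃ λ r₀ → (u , r₀) ∈ I × r ≡ r₀ * p u m × m Fin.< u × u ∈ₛ Γ′ m × α ≤ q * r₀ * p u m
  ∈-generateI⁻ C eq ur∈ with max C
  ∈-generateI⁻ C {q = q} refl ur∈ | just m with ∈-map⁻ _ ur∈
  ... | (u , r₀) , ur₀∈ , refl with ∈-filter⁻
    (λ (u , r) → m Fin.<? u ×-dec u ∈? Γ′ m ×-dec α ≤? q * r * p u m) ur₀∈
  ...   | ur₀∈I , m<u , u∈Γm , α≤ = r₀ , ur₀∈I , refl , m<u , u∈Γm , α≤

  ∈-generateX⁻ : ∀ C {m q X u r} → max C ≡ just m → (u , r) ∈ generateX C q X →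
                 ∃ λ r₀ → (u , r₀) ∈ X × r ≡ r₀ * p u m × u ∈ₛ Γ′ m × α ≤ q * r₀ * p u m
  ∈-generateX⁻ C eq ur∈ with max C
  ∈-generateX⁻ C {q = q} refl ur∈ | just m with ∈-map⁻ _ ur∈
  ... | (u , r₀) , ur₀∈ , refl with ∈-filter⁻
    (λ (u , r) → u ∈? Γ′ m ×-dec α ≤? q * r * p u m) ur₀∈
  ...   | ur₀∈X , u∈Γm , α≤ = r₀ , ur₀∈X , refl , u∈Γm , α≤

  -- What membership of (u , r) in I or X promises while C is the current clique.
  record Extends (C : Subset n) (q : Carrier) (ur : Fin n × Carrier) : Set (ℓ₁ ⊔ ℓ₂) where
    constructor extends
    field
      adjacent    : ∀ {c} → c ∈ₛ C → proj₁ ur ∈ₛ Γ′ c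
      r≈extension : proj₂ ur ≈ extension (proj₁ ur) C
      α≤q*r       : α ≤ q * proj₂ ur

  -- Serves `I` and `X` alike. Associativity turns the value tested by the generators into the new
  -- clique value times the new number of the pair.
  Extends-step : ∀ {C q m rₘ u r} → m ∉ₛ C → Extends C q (u , r) → u ∈ₛ Γ′ m → α ≤ q * rₘ * r * p u m →
                 Extends (C ∪ ⁅ m ⁆) (q * rₘ) (u , r * p u m)
  Extends-step {C} {q} {m} {rₘ} {u} {r} m∉C (extends adjacent r≈ _) u∈Γm α≤ = extends
    (λ c∈ → [ adjacent , (λ c∈⁅m⁆ → ≡.subst (λ c → u ∈ₛ Γ′ c) (≡.sym (x∈⁅y⁆⇒x≡y m c∈⁅m⁆)) u∈Γm) ]′
      (x∈p∪q⁻ C ⁅ m ⁆ c∈))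
    (≈-trans (*-congʳ r≈) (≈-sym (extension-∪ u m∉C)))
    (≤-respʳ (*-assoc (q * rₘ) r (p u m)) α≤)

  module _ (0≤1 : 0# ≤ 1#) {M : Subset n} (M-complete : Complete Γ′ M) (α≤weight : α ≤ weight M)
           (t≤∣M∣ : t ℕ.≤ ∣ M ∣)
           (maximal : ¬ (∃ λ v → v ∉ₛ M × IsαClique α (M ∪ ⁅ v ⁆))) where

    -- For such an entry `q * r` is the weight of the complete set `M ∪ ⁅ u ⁆`, which would then be
    -- a larger α-clique.
    no-extension : ∀ {q ur} → q ≈ weight M → ¬ Extends M q ur
    no-extension {q} {u , r} q≈ (extends adjacent r≈ α≤) = maximal (u , u∉M ,
      ≤-respʳ (≈-trans (≈-trans (*-cong q≈ r≈) (≈-sym (weight-∪ u∉M (Γ′⊆Γ ∘ adjacent))))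
                       (≈-sym (clq≈weight complete))) α≤)
      where
      u∉M : u ∉ₛ M
      u∉M = Γ-irrefl ∘ Γ′⊆Γ ∘ adjacent

      complete : Complete Γ (M ∪ ⁅ u ⁆)
      complete {a} {b} a∈ b∈ a≢b with x∈p∪q⁻ M ⁅ u ⁆ a∈ | x∈p∪q⁻ M ⁅ u ⁆ b∈
      ... | inj₁ a∈M | inj₁ b∈M = Γ′⊆Γ (M-complete a∈M b∈M a≢b)
      ... | inj₁ a∈M | inj₂ b∈u with refl ← x∈⁅y⁆⇒x≡y u b∈u = Γ′⊆Γ (adjacent a∈M)
      ... | inj₂ a∈u | inj₁ b∈M with refl ← x∈⁅y⁆⇒x≡y u a∈u = Γ-sym (Γ′⊆Γ (adjacent b∈M))
      ... | inj₂ a∈u | inj₂ b∈u =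
        contradiction (≡.trans (x∈⁅y⁆⇒x≡y u a∈u) (≡.sym (x∈⁅y⁆⇒x≡y u b∈u))) a≢b

    -- The state of a call on the branch towards `M`. `C<I` identifies the maximum after a vertex is
    -- added, `M⊆C∪I` keeps the missing vertices available, and `I-extend` and `X-extend` force `I`
    -- and `X` to be empty once `C` is `M`.
    record Invariant (C : Subset n) (q : Carrier) (I X : Pairs) : Set (c ⊔ ℓ₁ ⊔ ℓ₂) where
      field
        C⊆M      : C ⊆ₛ M
        q≈weight : q ≈ weight C
        I-extend : ∀ {ur} → ur ∈ I → Extends C q ur
        X-extend : ∀ {ur} → ur ∈ X → Extends C q ur
        C<I      : ∀ {ur} → ur ∈ I → ∀ {c} → c ∈ₛ C → c Fin.< proj₁ ur
        M⊆C∪I    : ∀ {u} → u ∈ₛ M → u ∉ₛ C → ∃ λ r → (u , r) ∈ I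

    -- `m` is the least missing vertex of `M` because `generateI` keeps only vertices above `m`:
    -- none of those still needed is lost.
    module Step {C q I X m r} (inv : Invariant C q I X) (m∈M : m ∈ₛ M) (m∉C : m ∉ₛ C)
                (least : ∀ {u} → u ∈ₛ M → u ∉ₛ C → m Fin.≤ u) (mr∈I : (m , r) ∈ I) where
      open Invariant inv

      C′ = C ∪ ⁅ m ⁆
      q′ = q * r

      max-C′ : max C′ ≡ just m
      max-C′ = max-∪⁅⁆ C (C<I mr∈I)

      m∈C′ : m ∈ₛ C′
      m∈C′ = q⊆p∪q C ⁅ m ⁆ (x∈⁅x⁆ m)

      C′⊆M : C′ ⊆ₛ M
      C′⊆M = ∪⁅⁆-⊆ C⊆M m∈M

      q′≈weight : q′ ≈ weight C′
      q′≈weight = ≈-trans (*-cong q≈weight (Extends.r≈extension (I-extend mr∈I)))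
        (≈-sym (weight-∪ m∉C (Γ′⊆Γ ∘ Extends.adjacent (I-extend mr∈I))))

      M⊆C′∪I′ : ∀ {u} → u ∈ₛ M → u ∉ₛ C′ → ∃ λ s → (u , s) ∈ generateI C′ q′ I
      M⊆C′∪I′ {u} u∈M u∉C′ with M⊆C∪I u∈M (u∉C′ ∘ p⊆p∪q ⁅ m ⁆)
      ... | s , us∈I = s * p u m ,
        ∈-generateI⁺ C′ max-C′ us∈I (Fin.≤∧≢⇒< (least u∈M (u∉C′ ∘ p⊆p∪q ⁅ m ⁆)) m≢u)
          (M-complete m∈M u∈M m≢u) α≤
        where
        open ≤-Reasoning ≤-poset
        m≢u : m ≢ u
        m≢u refl = u∉C′ m∈C′

        -- The tested value is the weight of `C′ ∪ ⁅ u ⁆`, a subset of `M`, hence at least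
        -- `weight M`.
        α≤ : α ≤ q′ * s * p u m
        α≤ = begin
          α
            ≤⟨ α≤weight ⟩
          weight M
            ≤⟨ weight-antitone 0≤1 (λ a∈ b∈ a≢b → Γ′⊆Γ (M-complete a∈ b∈ a≢b)) (∪⁅⁆-⊆ C′⊆M u∈M) ⟩
          weight (C′ ∪ ⁅ u ⁆)
            ≈⟨ weight-∪ u∉C′ (λ c∈ → Γ′⊆Γ (M-complete (C′⊆M c∈) u∈M λ { refl → u∉C′ c∈ })) ⟩
          weight C′ * extension u C′
            ≈⟨ *-cong (≈-sym q′≈weight) (extension-∪ u m∉C) ⟩
          q′ * (extension u C * p u m)
            ≈⟨ *-assoc q′ _ _ ⟨
          q′ * extension u C * p u m
            ≈⟨ *-congʳ (*-congˡ (Extends.r≈extension (I-extend us∈I))) ⟨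
          q′ * s * p u m
            ∎

      -- The vertices of `M` outside `C′` all occur in the new `I`, so the tested sum is at least
      -- `∣ M ∣`.
      not-skipped : ¬ (∣ C′ ∣ ℕ.+ length (generateI C′ q′ I) ℕ.< t)
      not-skipped = ℕ.≤⇒≯ (ℕ.≤-trans t≤∣M∣ (ℕ.≤-trans (p⊆q⇒∣p∣≤∣q∣ M⊆)
        (ℕ.≤-trans (∣p∪q∣≤∣p∣+∣q∣ C′ M∖C′) (ℕ.+-monoʳ-≤ ∣ C′ ∣ (∣p∣≤length _ (uncurry M⊆C′∪I′ ∘ ∈-select⁻ ∈M∖C′?))))))
        where
        ∈M∖C′? : ∀ u → Dec (u ∈ₛ M × u ∉ₛ C′)
        ∈M∖C′? u = u ∈? M ×-dec ¬? (u ∈? C′)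
        M∖C′ : Subset n
        M∖C′ = select ∈M∖C′?
        M⊆ : M ⊆ₛ C′ ∪ M∖C′
        M⊆ {u} u∈M with u ∈? C′
        ... | yes u∈C′ = x∈p∪q⁺ (inj₁ u∈C′)
        ... | no u∉C′  = x∈p∪q⁺ (inj₂ (∈-select⁺ ∈M∖C′? (u∈M , u∉C′)))

      invariant : Invariant C′ q′ (generateI C′ q′ I) (generateX C′ q′ X)
      invariant = record
        { C⊆M      = C′⊆M
        ; q≈weight = q′≈weight
        ; I-extend = λ us∈ → let _ , us₀∈I , eq , _ , u∈Γm , α≤ = ∈-generateI⁻ C′ max-C′ us∈ in
            ≡.subst (λ s → Extends C′ q′ (_ , s)) (≡.sym eq) (Extends-step m∉C (I-extend us₀∈I) u∈Γm α≤)
        ; X-extend = λ us∈ → let _ , us₀∈X , eq , u∈Γm , α≤ = ∈-generateX⁻ C′ max-C′ us∈ in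
            ≡.subst (λ s → Extends C′ q′ (_ , s)) (≡.sym eq) (Extends-step m∉C (X-extend us₀∈X) u∈Γm α≤)
        ; C<I      = λ us∈ c∈ → let _ , _ , _ , m<u , _ = ∈-generateI⁻ C′ max-C′ us∈ in
            ℕ.≤-<-trans (max-upper c∈ max-C′) m<u
        ; M⊆C∪I    = M⊆C′∪I′
        }

    private
      skip? : ∀ C q I u r → Dec (∣ C ∪ ⁅ u ⁆ ∣ ℕ.+ length (generateI (C ∪ ⁅ u ⁆) (q * r) I) ℕ.< t)
      skip? C q I u r = ∣ C ∪ ⁅ u ⁆ ∣ ℕ.+ length (generateI (C ∪ ⁅ u ⁆) (q * r) I) ℕ.<? t

    mutual
      -- If `I` is empty, no vertex of `M` is missing, so `C` is `M` and `X` must be empty too. If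
      -- `I` is not empty, `C` cannot be `M`, and the loop is followed to the least missing vertex.
      enumLarge-∈ : ∀ {C q} I X a → Invariant C q I X → M ∈ enumLarge C q I X a
      enumLarge-∈ {C} {q} [] X a inv with ⊆-antisym C⊆M M⊆C
        where
        open Invariant inv
        M⊆C : M ⊆ₛ C
        M⊆C {u} u∈M = decidable-stable (u ∈? C) λ u∉C → ¬Any[] (proj₂ (M⊆C∪I u∈M u∉C))
      enumLarge-∈ []       []        a inv | refl = here refl
      enumLarge-∈ []       (_ ∷ _)   a inv | refl =
        contradiction (Invariant.X-extend inv (here refl)) (no-extension (Invariant.q≈weight inv))
      enumLarge-∈ {C} {q} I@(_ ∷ _) X (acc rs) inv with Fin.all? (λ u → u ∈? M →-dec u ∈? C)
      ... | yes M⊆C with refl ← ⊆-antisym (Invariant.C⊆M inv) (M⊆C _) =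
        contradiction (Invariant.I-extend inv (here refl)) (no-extension (Invariant.q≈weight inv))
      ... | no M⊈C with least (λ u → u ∈? M →-dec u ∈? C) M⊈C
      ...   | m , m∈M∖C , m≤ =
        loop-∈ rs I id inv m∈M m∉C (λ u∈M u∉C → m≤ λ u∈M⇒u∈C → u∉C (u∈M⇒u∈C u∈M))
               (proj₂ (Invariant.M⊆C∪I inv m∈M m∉C))
        where
        m∈M : m ∈ₛ M
        m∈M = decidable-stable (m ∈? M) λ m∉M → m∈M∖C λ m∈M → contradiction m∈M m∉M
        m∉C : m ∉ₛ C
        m∉C m∈C = m∈M∖C λ _ → m∈C

      -- Entries before that of `m` are passed over, joining `X` unless skipped; the entry of `m`
      -- opens the recursive call whose output contains `M`.
      loop-∈ : ∀ {C q I X m r} (rs : ∀ {k} → k ℕ.< length I → Acc ℕ._<_ k) J (J⊆I : J ⊆ₗ I) →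
               Invariant C q I X → m ∈ₛ M → m ∉ₛ C → (∀ {u} → u ∈ₛ M → u ∉ₛ C → m Fin.≤ u) →
               (m , r) ∈ J → M ∈ loop C q I rs J J⊆I X
      loop-∈ {C} {q} {I} {X} rs ((u , r) ∷ J) J⊆I inv m∈M m∉C m≤ (here refl) =
        if-elim (skip? C q I u r) (M ∈_)
          (λ skipped → contradiction skipped (Step.not-skipped inv m∈M m∉C m≤ (J⊆I (here refl))))
          λ _ → ∈-++⁺ˡ (enumLarge-∈ (generateI (C ∪ ⁅ u ⁆) (q * r) I) (generateX (C ∪ ⁅ u ⁆) (q * r) X) (rs _)
            (Step.invariant inv m∈M m∉C m≤ (J⊆I (here refl))))
      loop-∈ {C} {q} {I} {X} rs ((u , r) ∷ J) J⊆I inv m∈M m∉C m≤ (there mr∈J) =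
        if-elim (skip? C q I u r) (M ∈_)
          (λ _ → loop-∈ rs J (J⊆I ∘ there) inv m∈M m∉C m≤ mr∈J)
          λ _ → ∈-++⁺ʳ _ (loop-∈ rs J (J⊆I ∘ there) inv′ m∈M m∉C m≤ mr∈J)
        where
        open Invariant inv
        inv′ : Invariant C q I ((u , r) ∷ X)
        inv′ = record
          { C⊆M      = C⊆M
          ; q≈weight = q≈weight
          ; I-extend = I-extend
          -- An entry moved to `X` comes from `I`, where it met the same condition for the same `C`
          -- and `q`.
          ; X-extend = λ { (here refl) → I-extend (J⊆I (here refl)) ; (there vs∈X) → X-extend vs∈X }
          ; C<I      = C<I
          ; M⊆C∪I    = M⊆C∪I
          }

-- The pruned graph and the initial call of the enumeration

lemma13 : ∀ {c ℓ₁ ℓ₂} (K : OrderedCommutativeRing c ℓ₁ ℓ₂) {n : ℕ} (𝒢 : UncertainGraph K n) →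
    let open OrderedCommutativeRing K in
    let open Cliques 𝒢 in
    ∀ (α : Carrier) → 0# < α → α < 1# →
    ∀ (t : ℕ) → 2 ℕ.≤ t →
    ∀ (M : Subset n) → IsαMaximalClique α M → t ℕ.< ∣ M ∣ →
    M ∈ largeMULE 𝒢 α t
lemma13 K {n} 𝒢 α 0<α α<1 t _ M (α≤clq , maximal) t<∣M∣ =
  enumLarge-∈ 𝒢 α t (Graph.Γ g′) (λ v∈ → proj₁ (∈-select⁻ (keep? _) (prune-⊆ t g v∈)))
    0≤1 (proj₂ M⊆g′) α≤weight t≤∣M∣ maximal _ [] _ record
      { C⊆M      = λ c∈⊥ → contradiction c∈⊥ ∉⊥
      ; q≈weight = ≈-sym weight-⊥
      ; I-extend = I-extend
      ; X-extend = λ ()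
      ; C<I      = λ _ c∈⊥ → contradiction c∈⊥ ∉⊥
      ; M⊆C∪I    = λ u∈M _ → 1# ,
          ∈-map⁺ (_, 1#) (∈-filter⁺ (_∈? Graph.V g′) (∈-allFin _) (proj₁ M⊆g′ u∈M))
      }
  where
  open OrderedCommutativeRing K hiding (zero) renaming (refl to ≈-refl; sym to ≈-sym; trans to ≈-trans)
  open OrderedRingProperties K
  open UncertainGraph 𝒢
  open CliqueProbability 𝒢

  keep? : ∀ u v → Dec (v ∈ₛ Γ u × α ≤ p u v)
  keep? u v = v ∈? Γ u ×-dec α ≤? p u v

  g g′ : Graph n
  g = graph ⊤ λ u → select (keep? u)
  g′ = Pruning.prune t g

  0≤1 : 0# ≤ 1#
  0≤1 = ≤-trans (proj₁ 0<α) (proj₁ α<1)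

  t≤∣M∣ : t ℕ.≤ ∣ M ∣
  t≤∣M∣ = ℕ.<⇒≤ t<∣M∣

  complete : Complete Γ M
  complete = αClique-complete 0<α α≤clq

  α≤weight : α ≤ weight M
  α≤weight = ≤-respʳ (clq≈weight complete) α≤clq

  -- An edge of `M` has probability at least `weight M`, hence at least `α`, so the initial removal
  -- of improbable edges keeps it.
  M⊆g′ : Contains t M t≤∣M∣ g′
  M⊆g′ = prune-Contains t M t≤∣M∣ g
    ( (λ _ → ∈⊤)
    , λ {u} u∈M v∈M u≢v → ∈-select⁺ (keep? u)
        (complete u∈M v∈M u≢v , ≤-trans α≤weight (weight≤p 0≤1 complete u∈M v∈M u≢v)))

  I-extend : ∀ {ur} → ur ∈ map (_, 1#) (filter (_∈? Graph.V g′) (allFin n)) →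
             Extends 𝒢 α t (Graph.Γ g′) _ ⊥ 1# ur
  I-extend ur∈ with ∈-map⁻ (_, 1#) ur∈
  ... | u , _ , refl = extends (λ c∈⊥ → contradiction c∈⊥ ∉⊥) (≈-sym (extension-⊥ u))
    -- At the root both numbers are `1#`, so the required bound `α ≤ 1# * 1#` comes from `α < 1#`.
    (≤-respʳ (≈-sym (*-identityˡ 1#)) (proj₁ α<1))
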